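{- Let $k\geq 3$ and $1\le t\le k-2$, and let $G$ be a graph with maximum degree $\Delta(G)\le k$ that is $t$-saturated. Then $G$ is $(1^{k-1},2)$-packing colorable.
   Context: Graphs are finite and simple; $\mathrm{dist}(x,y)$ is the usual shortest-path distance. For a non-decreasing sequence of positive integers $S=(s_1,\dots,s_p)$, an $S$-packing coloring of $G$ is a partition of $V(G)$ into sets $V_1,\dots,V_p$ such that any two distinct vertices of $V_i$ are at distance greater than $s_i$, for each $1\le i\le p$; $G$ is $S$-packing colorable if such a partition exists. The notation $i^r$ in a sequence means that $i$ is repeated $r$ times, so $(1^{k-1},2)$ is the sequence of $k-1$ ones followed by a single $2$. A vertex of degree $k$ is called a $k$-vertex. A graph $G$ with $\Delta(G)\le k$ is called $t$-saturated ($0\le t\le k$) if every $k$-vertex of $G$ is adjacent to at most $t$ vertices of degree $k$. -}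

module Defs where

open import Data.Nat using (ℕ; zero; suc; _≤_; _≡ᵇ_)
open import Data.Fin using (Fin)
open import Data.Bool using (Bool; true; false; _∧_)
open import Data.List using (List; length; filterᵇ; allFin)
open import Data.Vec using (Vec; lookup; _++_; replicate; _∷_; [])
open import Data.Product using (Σ; ∃; _×_)
open import Relation.Binary.PropositionalEquality using (_≡_; _≢_)
open import Relation.Nullary using (¬_)

record Graph (n : ℕ) : Set where
  field
    adj   : Fin n → Fin n → Bool
    sym   : ∀ x y → adj x y ≡ adj y x
    irrefl : ∀ x → adj x x ≡ false
open Graph public

deg : ∀ {n} → Graph n → Fin n → ℕ
deg G v = length (filterᵇ (adj G v) (allFin _))

MaxDegLe : ∀ {n} → Graph n → ℕ → Set
MaxDegLe G k = ∀ v → deg G v ≤ k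

kNeighbours : ∀ {n} → Graph n → ℕ → Fin n → ℕ
kNeighbours G k v = length (filterᵇ (λ u → adj G v u ∧ (deg G u ≡ᵇ k)) (allFin _))

Saturated : ∀ {n} → Graph n → ℕ → ℕ → Set
Saturated G k t = ∀ v → deg G v ≡ k → kNeighbours G k v ≤ t

data Walk {n} (G : Graph n) : Fin n → Fin n → ℕ → Set where
  nil  : ∀ {x} → Walk G x x 0
  cons : ∀ {x y z m} → adj G x y ≡ true → Walk G y z m → Walk G x z (suc m)

DistLe : ∀ {n} → Graph n → Fin n → Fin n → ℕ → Set
DistLe G x y d = ∃ λ m → m ≤ d × Walk G x y m

IsSPackingColoring : ∀ {n p} → Graph n → Vec ℕ p → (Fin n → Fin p) → Set
IsSPackingColoring {n} G S c =
  ∀ (x y : Fin n) → x ≢ y → c x ≡ c y → ¬ DistLe G x y (lookup S (c x))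

SPackingColorable : ∀ {n p} → Graph n → Vec ℕ p → Set
SPackingColorable {n} {p} G S = Σ (Fin n → Fin p) (IsSPackingColoring G S)

seq1k2 : (k : ℕ) → Vec ℕ (k Data.Nat.∸ 1 Data.Nat.+ 1)
seq1k2 k = replicate (k Data.Nat.∸ 1) 1 ++ (2 ∷ [])

{-# OPTIONS --safe #-}
module Submission where

-- Let q = k - 1 and κ x = [deg x = k].  Among all q-colourings c, proper or not,
-- take one minimising the total weight of monochromatic edges, where xy weighs
-- 2 + κ x κ y.  From each monochromatic edge remove the end with the smaller κ
-- (ties broken by the vertex order); what is left is properly coloured.
-- Saturation bounds the total weight at x by q (2 + κ x) + κ x, with two effects:
-- (a) recolouring a removed vertex r, to any colour, costs at most κ r;
-- (b) in any colouring, a vertex with two neighbours y, z of its own colour can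
--     be recoloured with a gain exceeding κ y + κ z.
-- If removed vertices r, s are adjacent, give r the colour of s
-- and then let s escape by (b), since r and the other end of the monochromatic
-- edge at s now share its colour; if they have a common neighbour w, give both the
-- colour of w and let w escape.  Either way the total drops below the minimum.

open import Defs
open import Data.Nat using (ℕ; _≤_; _∸_; zero; suc; _+_; _*_; _<_; _≡ᵇ_; z≤n; s≤s; s≤s⁻¹)
open import Data.Nat.Properties hiding (_≟_)
open import Algebra.Properties.CommutativeMonoid.Sum +-0-commutativeMonoid
  using (sum; sum-cong-≗; ∑-distrib-+; ∑-comm; sum-remove; sum-replicate-zero)
open import Algebra.Properties.Semiring.Sum +-*-semiring using (*-distribˡ-sum)
open import Data.Nat.Tactic.RingSolver using (solve-∀)
open import Data.Bool using (Bool; true; false; _∧_; if_then_else_)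
open import Data.Bool.Properties using (T-≡) renaming (_≟_ to _≟ᵇ_)
open import Data.Fin using (Fin; zero; suc; punchIn; punchOut; _↑ˡ_; _↑ʳ_; splitAt)
open import Data.Fin.Properties
  using (_≟_; any?; ¬∀⟶∃¬; punchInᵢ≢i; punchIn-punchOut; ↑ˡ-injective; splitAt-↑ˡ; splitAt-↑ʳ)
  renaming (<-strictTotalOrder to Fin-<-strictTotalOrder)
open import Data.List using (length; filterᵇ; tabulate; allFin)
open import Data.List.Extrema ≤-totalOrder using (argmin; f[argmin]≤f[xs])
import Data.List.Relation.Unary.All as All
open import Data.List.Membership.Propositional.Properties using (∈-allFin)
open import Data.Product using (∃; _×_; _,_; proj₁; proj₂)
open import Data.Product.Relation.Binary.Lex.Strict using (×-strictTotalOrder)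
open import Data.Sum using (_⊎_; inj₁; inj₂)
open import Data.Empty using (⊥; ⊥-elim)
open import Data.Vec using (replicate; _++_; _∷_; [])
open import Data.Vec.Functional using (Vector; updateAt; removeAt)
open import Data.Vec.Functional.Properties using (updateAt-updates; updateAt-minimal)
open import Data.Vec.Properties using (lookup-++ˡ; lookup-++ʳ; lookup-replicate)
open import Function using (_∘_; const; id; Equivalence)
open import Relation.Binary using (StrictTotalOrder; tri<; tri≈; tri>)
open import Relation.Binary.PropositionalEquality
  using (_≡_; _≢_; _≗_; refl; trans; cong; cong₂; subst; subst₂; ≢-sym; module ≡-Reasoning)
  renaming (sym to ≡-sym)
open import Relation.Nullary using (¬_; Dec; yes; no; does; contradiction)
open import Relation.Nullary.Decidable using (dec-true; dec-false; _×-dec_)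

-- Sums over `Fin n`, and minimisation over colourings.

term≤sum : ∀ {n} (f : Vector ℕ n) i → f i ≤ sum f
term≤sum {suc n} f i = begin
  f i                       ≤⟨ m≤m+n _ _ ⟩
  f i + sum (removeAt f i)  ≡⟨ sum-remove {i = i} f ⟨
  sum f                     ∎
  where open ≤-Reasoning

two-terms≤sum : ∀ {n} (f : Vector ℕ n) {i j} → i ≢ j → f i + f j ≤ sum f
two-terms≤sum {suc n} f {i} {j} i≢j = begin
  f i + f j                              ≡⟨ cong (λ x → f i + f x) (punchIn-punchOut i≢j) ⟨
  f i + removeAt f i (punchOut i≢j)      ≤⟨ +-monoʳ-≤ (f i) (term≤sum (removeAt f i) (punchOut i≢j)) ⟩
  f i + sum (removeAt f i)               ≡⟨ sum-remove {i = i} f ⟨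
  sum f                                  ∎
  where open ≤-Reasoning

n*lower≤sum : ∀ {n m} (f : Vector ℕ n) → (∀ i → m ≤ f i) → n * m ≤ sum f
n*lower≤sum {zero}  f m≤f = z≤n
n*lower≤sum {suc n} f m≤f = +-mono-≤ (m≤f zero) (n*lower≤sum (f ∘ suc) (m≤f ∘ suc))

-- Charging `m` to each of the other `n - 1` terms bounds a single term from above. The extra `m` on
-- the right stands in for a subtraction on the left.
term+lower≤sum : ∀ {n m} (f : Vector ℕ n) → (∀ i → m ≤ f i) → ∀ i → f i + n * m ≤ sum f + m
term+lower≤sum {suc n} {m} f m≤f i = begin
  f i + (m + n * m)             ≡⟨ rearr (f i) m (n * m) ⟩
  (f i + n * m) + m             ≤⟨ +-monoˡ-≤ m (+-monoʳ-≤ (f i) (n*lower≤sum (removeAt f i) (m≤f ∘ punchIn i))) ⟩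
  f i + sum (removeAt f i) + m  ≡⟨ cong (_+ m) (sum-remove {i = i} f) ⟨
  sum f + m                     ∎
  where
  open ≤-Reasoning
  rearr : ∀ a b c → a + (b + c) ≡ (a + c) + b
  rearr = solve-∀

sum-indicator : ∀ {n} (j : Fin n) a → sum (λ i → if does (j ≟ i) then a else 0) ≡ a
sum-indicator {suc n} zero    a = trans (cong (a +_) (sum-replicate-zero n)) (+-identityʳ a)
sum-indicator {suc n} (suc j) a = sum-indicator j a

length-filterᵇ-tabulate : ∀ {n} {A : Set} (f : A → Bool) (g : Fin n → A) →
  length (filterᵇ f (tabulate g)) ≡ sum (λ i → if f (g i) then 1 else 0)
length-filterᵇ-tabulate {zero}  f g = refl
length-filterᵇ-tabulate {suc n} f g with f (g zero)
... | true  = cong suc (length-filterᵇ-tabulate f (g ∘ suc))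
... | false = length-filterᵇ-tabulate f (g ∘ suc)

-- Isolates everything that involves `v`. By symmetry column `v` sums to the same as row `v`. The
-- column left over after removing the row lacks the diagonal entry, which is harmless because that
-- entry is 0.
symmetric-sum-remove : ∀ {n} (B : Fin (suc n) → Fin (suc n) → ℕ) v →
  (∀ x y → B x y ≡ B y x) → B v v ≡ 0 →
  sum (λ x → sum (B x)) ≡
  sum (B v) + sum (B v) + sum (λ x → sum (λ y → B (punchIn v x) (punchIn v y)))
symmetric-sum-remove B v B-sym Bvv≡0 = begin
  sum (λ x → sum (B x))
    ≡⟨ sum-remove {i = v} (λ x → sum (B x)) ⟩
  sum (B v) + sum (λ x → sum (B (punchIn v x)))
    ≡⟨ cong (sum (B v) +_) (sum-cong-≗ λ x → sum-remove {i = v} (B (punchIn v x))) ⟩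
  sum (B v) + sum (λ x → B (punchIn v x) v + sum (rest x))
    ≡⟨ cong (sum (B v) +_) (∑-distrib-+ (λ x → B (punchIn v x) v) (sum ∘ rest)) ⟩
  sum (B v) + (sum (λ x → B (punchIn v x) v) + sum (sum ∘ rest))
    ≡⟨ cong (λ s → sum (B v) + (s + sum (sum ∘ rest))) column ⟩
  sum (B v) + (sum (B v) + sum (sum ∘ rest))
    ≡⟨ +-assoc (sum (B v)) _ _ ⟨
  sum (B v) + sum (B v) + sum (sum ∘ rest) ∎
  where
  open ≡-Reasoning
  rest = λ x y → B (punchIn v x) (punchIn v y)
  column : sum (λ x → B (punchIn v x) v) ≡ sum (B v)
  column = begin
    sum (λ x → B (punchIn v x) v)        ≡⟨ sum-cong-≗ (λ x → B-sym (punchIn v x) v) ⟩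
    sum (removeAt (B v) v)               ≡⟨ cong (_+ sum (removeAt (B v) v)) Bvv≡0 ⟨
    B v v + sum (removeAt (B v) v)       ≡⟨ sum-remove {i = v} (B v) ⟨
    sum (B v)                            ∎

-- Induction on the number of vertices: minimise over the tail for each first colour, then take the
-- best first colour. `Φ-cong` does the work of function extensionality, and `suc p` provides the
-- default colour that `argmin` needs.
minimiser : ∀ {n p} (Φ : (Fin n → Fin (suc p)) → ℕ) → (∀ {c d} → c ≗ d → Φ c ≡ Φ d) →
  ∃ λ c → ∀ d → Φ c ≤ Φ d
minimiser {zero} Φ Φ-cong = (λ ()) , λ d → ≤-reflexive (Φ-cong λ ())
minimiser {suc n} {p} Φ Φ-cong = best i₀ , λ d → begin
  Φ (best i₀)                    ≤⟨ All.lookup (f[argmin]≤f[xs] {f = Φ ∘ best} zero (allFin _)) (∈-allFin (d zero)) ⟩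
  Φ (best (d zero))              ≤⟨ proj₂ (tail-min (d zero)) (d ∘ suc) ⟩
  Φ (d zero ∷ᶠ (d ∘ suc))        ≡⟨ Φ-cong (λ { zero → refl ; (suc _) → refl }) ⟩
  Φ d                            ∎
  where
  open ≤-Reasoning
  open Data.Vec.Functional using () renaming (_∷_ to _∷ᶠ_)
  tail-min : ∀ i → ∃ λ c → ∀ d → Φ (i ∷ᶠ c) ≤ Φ (i ∷ᶠ d)
  tail-min i = minimiser (λ c → Φ (i ∷ᶠ c)) λ c≗d → Φ-cong λ { zero → refl ; (suc x) → c≗d x }
  best : Fin (suc p) → Fin (suc n) → Fin (suc p)
  best i = i ∷ᶠ proj₁ (tail-min i)
  i₀ = argmin (Φ ∘ best) zero (allFin _)

does-≟-sym : ∀ {p} (i j : Fin p) → does (i ≟ j) ≡ does (j ≟ i)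
does-≟-sym i j with i ≟ j
... | yes i≡j = ≡-sym (dec-true (j ≟ i) (≡-sym i≡j))
... | no  i≢j = ≡-sym (dec-false (j ≟ i) (i≢j ∘ ≡-sym))

if-both : ∀ {A : Set} b {a : A} → (if b then a else a) ≡ a
if-both true  = refl
if-both false = refl

-- Loads of colours at a vertex, and total monochromatic weight.

module _ {n p : ℕ} (A : Fin n → Fin n → ℕ) where

  -- Here `i` may differ from `c x`: for `A` with zero diagonal, this is what `x` would pay after
  -- moving to colour `i`.
  load : (Fin n → Fin p) → Fin n → Fin p → ℕ
  load c x i = sum λ y → if does (c y ≟ i) then A x y else 0

  -- Sums over ordered pairs, so for symmetric `A` each monochromatic edge counts twice; this is the
  -- source of every `double` below.
  monochromatic : (Fin n → Fin p) → ℕ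
  monochromatic c = sum λ x → load c x (c x)

  load-cong : ∀ {c d} x i → (∀ y → A x y ≡ 0 ⊎ c y ≡ d y) → load c x i ≡ load d x i
  load-cong {c} {d} x i agree = sum-cong-≗ term
    where
    term : ∀ y → (if does (c y ≟ i) then A x y else 0) ≡ (if does (d y ≟ i) then A x y else 0)
    term y with agree y
    ... | inj₁ Axy≡0 rewrite Axy≡0 = trans (if-both (does (c y ≟ i))) (≡-sym (if-both (does (d y ≟ i))))
    ... | inj₂ cy≡dy rewrite cy≡dy = refl

  monochromatic-cong : ∀ {c d} → c ≗ d → monochromatic c ≡ monochromatic d
  monochromatic-cong {c} {d} c≗d = sum-cong-≗ λ x →
    trans (cong (load c x) (c≗d x)) (load-cong x (d x) (inj₂ ∘ c≗d))

  sum-load : ∀ c x → sum (load c x) ≡ sum (A x)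
  sum-load c x = trans (∑-comm (λ i y → if does (c y ≟ i) then A x y else 0))
                       (sum-cong-≗ λ y → sum-indicator (c y) (A x y))

  two-own≤load : ∀ c {x y z} → y ≢ z → c y ≡ c x → c z ≡ c x → A x y + A x z ≤ load c x (c x)
  two-own≤load c {x} {y} {z} y≢z cy≡cx cz≡cx = subst₂ (λ a b → a + b ≤ load c x (c x))
    (own cy≡cx) (own cz≡cx)
    (two-terms≤sum (λ y → if does (c y ≟ c x) then A x y else 0) y≢z)
    where
    own : ∀ {y} → c y ≡ c x → (if does (c y ≟ c x) then A x y else 0) ≡ A x y
    own {y} eq = cong (if_then A x y else 0) (dec-true (c y ≟ c x) eq)

  own≤load : ∀ c {x y} → c y ≡ c x → A x y ≤ load c x (c x)
  own≤load c {x} {y} cy≡cx = subst (_≤ load c x (c x))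
    (cong (if_then A x y else 0) (dec-true (c y ≟ c x) cy≡cx))
    (term≤sum (λ y → if does (c y ≟ c x) then A x y else 0) y)

-- The effect of recolouring one vertex.

recolour : ∀ {n p} → (Fin n → Fin p) → Fin n → Fin p → Fin n → Fin p
recolour c v i = updateAt c v (const i)

recolour-other : ∀ {n p} (c : Fin n → Fin p) {v} {i} {x} → x ≢ v → recolour c v i x ≡ c x
recolour-other c {v} {x = x} x≢v = updateAt-minimal x v c x≢v

recolour-self : ∀ {n p} (c : Fin n → Fin p) v {i} → recolour c v i v ≡ i
recolour-self c v = updateAt-updates v c

load-recolour : ∀ {n p} (A : Fin n → Fin n → ℕ) (c : Fin n → Fin p) {v i} x j →
  A x v ≡ 0 → load A (recolour c v i) x j ≡ load A c x j
load-recolour A c {v} {i} x j Axv≡0 = load-cong A x j agree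
  where
  agree : ∀ y → A x y ≡ 0 ⊎ recolour c v i y ≡ c y
  agree y with y ≟ v
  ... | yes refl = inj₁ Axv≡0
  ... | no  y≢v  = inj₂ (recolour-other c y≢v)

-- Only pairs involving `v` change, and they contribute twice the load at `v`, once as a row and
-- once as a column. The difference of the two totals is written additively to stay in `ℕ`.
monochromatic-recolour : ∀ {n p} (A : Fin n → Fin n → ℕ) →
  (∀ x y → A x y ≡ A y x) → (∀ x → A x x ≡ 0) →
  ∀ (c : Fin n → Fin p) v i →
  monochromatic A (recolour c v i) + (load A c v (c v) + load A c v (c v)) ≡
  monochromatic A c + (load A c v i + load A c v i)
monochromatic-recolour {suc n} A A-sym A-irrefl c v i = begin
  monochromatic A c′ + (s + s)    ≡⟨ cong (_+ (s + s)) (split c′) ⟩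
  (s′ + s′) + off c′ + (s + s)    ≡⟨ cong₂ (λ a b → (a + a) + b + (s + s)) s′≡ off≡ ⟩
  (t + t) + off c + (s + s)       ≡⟨ rearr t (off c) s ⟩
  (s + s) + off c + (t + t)       ≡⟨ cong (_+ (t + t)) (split c) ⟨
  monochromatic A c + (t + t)     ∎
  where
  open ≡-Reasoning
  c′ = recolour c v i
  B = λ d x y → if does (d y ≟ d x) then A x y else 0
  off = λ d → sum λ x → sum λ y → B d (punchIn v x) (punchIn v y)
  s = load A c v (c v)
  s′ = load A c′ v (c′ v)
  t = load A c v i
  split : ∀ d → monochromatic A d ≡ load A d v (d v) + load A d v (d v) + off d
  split d = symmetric-sum-remove (B d) v
    (λ x y → cong₂ (if_then_else 0) (does-≟-sym (d y) (d x)) (A-sym x y))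
    (trans (cong (if does (d v ≟ d v) then_else 0) (A-irrefl v)) (if-both (does (d v ≟ d v))))
  s′≡ : s′ ≡ t
  s′≡ = trans (cong (load A c′ v) (recolour-self c v)) (load-recolour A c v i (A-irrefl v))
  away : ∀ x → c′ (punchIn v x) ≡ c (punchIn v x)
  away x = recolour-other c (punchInᵢ≢i v x)
  off≡ : off c′ ≡ off c
  off≡ = sum-cong-≗ λ x → sum-cong-≗ λ y →
    cong₂ (λ i j → if does (i ≟ j) then A (punchIn v x) (punchIn v y) else 0) (away y) (away x)
  rearr : ∀ a b c → (a + a) + b + (c + c) ≡ (c + c) + b + (a + a)
  rearr = solve-∀

-- Edge weights and the arithmetic of escaping.

module _ {n : ℕ} (G : Graph n) (κ : Fin n → ℕ) where

  weight : Fin n → Fin n → ℕ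
  weight x y = if adj G x y then 2 + κ x * κ y else 0

  weight-adj : ∀ {x y} → adj G x y ≡ true → weight x y ≡ 2 + κ x * κ y
  weight-adj {x} {y} xy = cong (if_then 2 + κ x * κ y else 0) xy

  weight-¬adj : ∀ {x y} → adj G x y ≢ true → weight x y ≡ 0
  weight-¬adj {x} {y} ¬xy with adj G x y
  ... | true  = contradiction refl ¬xy
  ... | false = refl

  weight-sym : ∀ x y → weight x y ≡ weight y x
  weight-sym x y = cong₂ (λ b m → if b then 2 + m else 0) (sym G x y) (*-comm (κ x) (κ y))

  weight-irrefl : ∀ x → weight x x ≡ 0
  weight-irrefl x = cong (if_then 2 + κ x * κ x else 0) (irrefl G x)

  adj⇒≢ : ∀ {x y} → adj G x y ≡ true → x ≢ y
  adj⇒≢ {x} xy refl with () ← trans (≡-sym xy) (irrefl G x)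

  adj-sym : ∀ {x y} → adj G x y ≡ true → adj G y x ≡ true
  adj-sym {x} {y} = trans (sym G y x)

m*n≡m : ∀ {m n} → m ≤ 1 → m ≤ n → n ≤ 1 → m * n ≡ m
m*n≡m {zero}  _ _ _ = refl
m*n≡m {suc zero} {suc zero} _ _ _ = refl
m*n≡m {suc zero} {suc (suc _)} _ _ (s≤s ())
m*n≡m {suc (suc _)} (s≤s ())

-- With κ = [deg = k], the total q (2 + κ) + κ is what (k - 2)-saturation gives.
escape-bound : ∀ {q κ o s} → κ ≤ 1 → 2 ≤ q → 4 ≤ o → s ≤ q * (2 + κ) + κ →
  ¬ (o + q * (2 + 2 * κ) ≤ s + (2 + 2 * κ))
escape-bound {q} {κ} {o} {s} κ≤1 2≤q 4≤o s≤ o≤ = <-irrefl refl (begin-strict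
  q * (2 + κ) + (q * κ + 4)              ≡⟨ lhs q κ ⟨
  4 + q * (2 + 2 * κ)                    ≤⟨ +-monoˡ-≤ _ 4≤o ⟩
  o + q * (2 + 2 * κ)                    ≤⟨ o≤ ⟩
  s + (2 + 2 * κ)                        ≤⟨ +-monoˡ-≤ _ s≤ ⟩
  q * (2 + κ) + κ + (2 + 2 * κ)          ≡⟨ rhs q κ ⟩
  q * (2 + κ) + (2 * κ + κ + 2)          <⟨ +-monoʳ-< (q * (2 + κ)) small ⟩
  q * (2 + κ) + (q * κ + 4)              ∎)
  where
  open ≤-Reasoning
  lhs : ∀ q κ → 4 + q * (2 + 2 * κ) ≡ q * (2 + κ) + (q * κ + 4)
  lhs = solve-∀
  rhs : ∀ q κ → q * (2 + κ) + κ + (2 + 2 * κ) ≡ q * (2 + κ) + (2 * κ + κ + 2)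
  rhs = solve-∀
  small : 2 * κ + κ + 2 < q * κ + 4
  small = begin-strict
    2 * κ + κ + 2   ≤⟨ +-monoˡ-≤ 2 (+-mono-≤ (*-monoˡ-≤ κ 2≤q) κ≤1) ⟩
    q * κ + 1 + 2   ≡⟨ +-assoc (q * κ) 1 2 ⟩
    q * κ + 3       <⟨ +-monoʳ-< (q * κ) (n<1+n 3) ⟩
    q * κ + 4       ∎

-- The right side is the weight of two edges at a vertex of value `κ`. If `κ` is 0, then `l` is at
-- most 1 and `m + m′` at most 2, short of 4; if `κ` is 1, `m + m′` cancels and `l < 4` remains. The
-- threshold `2 + 2 * κ` fits both cases.
escape-gain : ∀ {κ l m m′} → κ ≤ 1 → m ≤ 1 → m′ ≤ 1 → l < 2 + 2 * κ →
  l + (m + m′) < (2 + κ * m) + (2 + κ * m′)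
escape-gain {zero} {l} {m} {m′} _ m≤1 m′≤1 l<2 = +-mono-≤ l<2 (+-mono-≤ m≤1 m′≤1)
escape-gain {suc zero} {l} {m} {m′} _ _ _ l<4 = begin-strict
  l + (m + m′)                       <⟨ +-monoˡ-< (m + m′) l<4 ⟩
  4 + (m + m′)                       ≡⟨ rearr m m′ ⟩
  (2 + 1 * m) + (2 + 1 * m′)         ∎
  where
  open ≤-Reasoning
  rearr : ∀ m m′ → 4 + (m + m′) ≡ (2 + 1 * m) + (2 + 1 * m′)
  rearr = solve-∀
escape-gain {suc (suc _)} (s≤s ())

↑ˡ≢↑ʳ : ∀ {m n} (i : Fin m) (j : Fin n) → i ↑ˡ n ≢ m ↑ʳ j
↑ˡ≢↑ʳ {m} {n} i j eq with () ← trans (≡-sym (splitAt-↑ˡ m i n)) (trans (cong (splitAt m) eq) (splitAt-↑ʳ m n j))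

-- Escaping from two neighbours of the same colour.

module Extremal {n q : ℕ} (2≤q : 2 ≤ q) (G : Graph n) (κ : Fin n → ℕ) (κ≤1 : ∀ x → κ x ≤ 1)
  (sum-weight : ∀ x → sum (weight G κ x) ≤ q * (2 + κ x) + κ x) where

  private
    A = weight G κ
    Φ = monochromatic {n} {q} A
    double : ℕ → ℕ
    double m = m + m

  sum-load≤ : ∀ (c : Fin n → Fin q) x → sum (load A c x) ≤ q * (2 + κ x) + κ x
  sum-load≤ c x = ≤-trans (≤-reflexive (sum-load A c x)) (sum-weight x)

  Φ-recolour : ∀ c v i → Φ (recolour c v i) + double (load A c v (c v)) ≡ Φ c + double (load A c v i)
  Φ-recolour = monochromatic-recolour A (weight-sym G κ) (weight-irrefl G κ)

  Edge : Fin n → Fin n → Set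
  Edge x y = adj G x y ≡ true

  -- Two like-coloured neighbours make the own load of `x` at least 4. Were every colour to have
  -- load at least `2 + 2 * κ x`, the loads would sum to more than `sum-weight` allows, so a lighter
  -- colour exists and `x` moves there.
  escape : ∀ (c : Fin n → Fin q) {x y z} → y ≢ z → Edge x y → Edge x z → c y ≡ c x → c z ≡ c x →
    ∃ λ d → Φ d + double (κ y + κ z) < Φ c
  escape c {x} {y} {z} y≢z xy xz cy≡cx cz≡cx = recolour c x l , +-cancelʳ-< (double own) _ _ (begin-strict
    Φ (recolour c x l) + double k + double own  ≡⟨ swap (Φ (recolour c x l)) (double k) (double own) ⟩
    Φ (recolour c x l) + double own + double k  ≡⟨ cong (_+ double k) (Φ-recolour c x l) ⟩
    Φ c + double (load A c x l) + double k      ≡⟨ merge (Φ c) (load A c x l) k ⟩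
    Φ c + double (load A c x l + k)             <⟨ +-monoʳ-< (Φ c) (+-mono-< gain gain) ⟩
    Φ c + double own                            ∎)
    where
    open ≤-Reasoning
    swap : ∀ a b c → a + b + c ≡ a + c + b
    swap = solve-∀
    merge : ∀ a b c → a + (b + b) + (c + c) ≡ a + ((b + c) + (b + c))
    merge = solve-∀
    k = κ y + κ z
    own = load A c x (c x)
    W≤own : (2 + κ x * κ y) + (2 + κ x * κ z) ≤ own
    W≤own = subst₂ (λ a b → a + b ≤ own) (weight-adj G κ xy) (weight-adj G κ xz)
      (two-own≤load A c y≢z cy≡cx cz≡cx)
    4≤own : 4 ≤ own
    4≤own = ≤-trans (+-mono-≤ (m≤m+n 2 _) (m≤m+n 2 _)) W≤own
    light : ∃ λ l → ¬ (2 + 2 * κ x ≤ load A c x l)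
    light = ¬∀⟶∃¬ q _ (λ l → 2 + 2 * κ x ≤? load A c x l) λ heavy →
      escape-bound (κ≤1 x) 2≤q 4≤own (sum-load≤ c x) (term+lower≤sum (load A c x) heavy (c x))
    l = proj₁ light
    gain : load A c x l + k < own
    gain = <-≤-trans (escape-gain (κ≤1 x) (κ≤1 y) (κ≤1 z) (≰⇒> (proj₂ light))) W≤own

  -- Costs and forbidden configurations at a minimal colouring.

  module Minimal (c : Fin n → Fin q) (c-min : ∀ d → Φ c ≤ Φ d) where

    own-least : ∀ x i → load A c x (c x) ≤ load A c x i
    own-least x i = ≮⇒≥ λ lt → <-irrefl refl (begin-strict
      Φ c + double (load A c x i)                            <⟨ +-monoʳ-< (Φ c) (+-mono-< lt lt) ⟩
      Φ c + double (load A c x (c x))                        ≤⟨ +-monoˡ-≤ _ (c-min (recolour c x i)) ⟩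
      Φ (recolour c x i) + double (load A c x (c x))         ≡⟨ Φ-recolour c x i ⟩
      Φ c + double (load A c x i)                            ∎)
      where open ≤-Reasoning

    Mate : Fin n → Fin n → Set
    Mate r r′ = Edge r r′ × c r ≡ c r′ × κ r ≤ κ r′

    -- Since `κ` is 0 or 1 and `κ r ≤ κ r′`, the edge to the mate weighs exactly `m = 2 + κ r`. The
    -- own load is thus at least `m`, and by minimality so is the load of every colour. The total
    -- exceeds `q * m` by at most `κ r`, so no single colour can rise further than that above the
    -- own load.
    excess : ∀ {r r′} → Mate r r′ → ∀ i → load A c r i ≤ load A c r (c r) + κ r
    excess {r} {r′} (rr′ , same , κ≤) i = +-cancelʳ-≤ (q * m) _ _ (begin
      load A c r i + q * m                  ≤⟨ term+lower≤sum (load A c r) (λ j → ≤-trans m≤own (own-least r j)) i ⟩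
      sum (load A c r) + m                  ≤⟨ +-mono-≤ (sum-load≤ c r) m≤own ⟩
      q * m + κ r + load A c r (c r)        ≡⟨ rearr (q * m) (κ r) _ ⟩
      load A c r (c r) + κ r + q * m        ∎)
      where
      open ≤-Reasoning
      rearr : ∀ a b c → a + b + c ≡ c + b + a
      rearr = solve-∀
      m = 2 + κ r
      m≤own : m ≤ load A c r (c r)
      m≤own = subst (_≤ load A c r (c r))
        (trans (weight-adj G κ rr′) (cong (2 +_) (m*n≡m (κ≤1 r) κ≤ (κ≤1 r′))))
        (own≤load A c (≡-sym same))

    recolour-cost : ∀ {r r′} → Mate r r′ → ∀ i → Φ (recolour c r i) ≤ Φ c + double (κ r)
    recolour-cost {r} mate i = +-cancelʳ-≤ (double own) _ _ (begin
      Φ (recolour c r i) + double own     ≡⟨ Φ-recolour c r i ⟩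
      Φ c + double (load A c r i)         ≤⟨ +-monoʳ-≤ (Φ c) (+-mono-≤ (excess mate i) (excess mate i)) ⟩
      Φ c + double (own + κ r)            ≡⟨ rearr (Φ c) own (κ r) ⟩
      Φ c + double (κ r) + double own     ∎)
      where
      open ≤-Reasoning
      own = load A c r (c r)
      rearr : ∀ a b c → a + ((b + c) + (b + c)) ≡ a + (c + c) + (b + b)
      rearr = solve-∀

    -- As `s` is not adjacent to `r`, recolouring `r` leaves every load at `s` unchanged, so the two
    -- costs simply add.
    recolour-cost₂ : ∀ {r r′ s s′} → Mate r r′ → Mate s s′ → r ≢ s → ¬ Edge s r → ∀ i →
      Φ (recolour (recolour c r i) s i) ≤ Φ c + double (κ r + κ s)
    recolour-cost₂ {r} {s = s} mate-r mate-s r≢s ¬sr i = +-cancelʳ-≤ (double own) _ _ (begin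
      Φ (recolour c₁ s i) + double own                  ≡⟨ cong (λ a → Φ (recolour c₁ s i) + double a) own≡ ⟨
      Φ (recolour c₁ s i) + double (load A c₁ s (c₁ s)) ≡⟨ Φ-recolour c₁ s i ⟩
      Φ c₁ + double (load A c₁ s i)                     ≡⟨ cong (λ a → Φ c₁ + double a) (unaffected i) ⟩
      Φ c₁ + double (load A c s i)                      ≤⟨ +-mono-≤ (recolour-cost mate-r i) (+-mono-≤ (excess mate-s i) (excess mate-s i)) ⟩
      Φ c + double (κ r) + double (own + κ s)           ≡⟨ rearr (Φ c) (κ r) own (κ s) ⟩
      Φ c + double (κ r + κ s) + double own             ∎)
      where
      open ≤-Reasoning
      c₁ = recolour c r i
      own = load A c s (c s)
      unaffected : ∀ j → load A c₁ s j ≡ load A c s j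
      unaffected j = load-recolour A c s j (weight-¬adj G κ ¬sr)
      own≡ : load A c₁ s (c₁ s) ≡ own
      own≡ = trans (cong (load A c₁ s) (recolour-other c (≢-sym r≢s))) (unaffected (c s))
      rearr : ∀ a b c d → a + (b + b) + ((c + d) + (c + d)) ≡ a + ((b + d) + (b + d)) + (c + c)
      rearr = solve-∀

    no-escape : ∀ d {m} → Φ d ≤ Φ c + m → ¬ (∃ λ d′ → Φ d′ + m < Φ d)
    no-escape d {m} Φd≤ (d′ , lt) = <-irrefl refl (begin-strict
      Φ d′ + m  <⟨ lt ⟩
      Φ d       ≤⟨ Φd≤ ⟩
      Φ c + m   ≤⟨ +-monoˡ-≤ m (c-min d′) ⟩
      Φ d′ + m  ∎)
      where open ≤-Reasoning

    -- If `r ≢ s′`, giving `r` the colour of `s` leaves `s` with two distinct neighbours of its own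
    -- colour, and its escape gains more than was paid. When `r` is itself the mate of `s` there is
    -- only one such neighbour; that case is left to the tie-break.
    adjacent⇒mates : ∀ {r r′ s s′} → Mate r r′ → Mate s s′ → Edge r s → r ≡ s′
    adjacent⇒mates {r} {r′} {s} {s′} mate-r (ss′ , same , _) rs with r ≟ s′
    ... | yes r≡s′ = r≡s′
    ... | no  r≢s′ = ⊥-elim (no-escape d cost
            (escape d r≢s′ (adj-sym G κ rs) ss′ (trans (recolour-self c r) (≡-sym ds≡)) (trans ds′≡ (≡-sym ds≡))))
      where
      d = recolour c r (c s)
      ds≡ : d s ≡ c s
      ds≡ = recolour-other c (≢-sym (adj⇒≢ G κ rs))
      ds′≡ : d s′ ≡ c s
      ds′≡ = trans (recolour-other c (≢-sym r≢s′)) (≡-sym same)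
      -- Only `κ r` is paid; the bound is padded with `κ s′` to match the gain that `escape`
      -- guarantees.
      cost : Φ d ≤ Φ c + double (κ r + κ s′)
      cost = ≤-trans (recolour-cost mate-r (c s))
        (+-monoʳ-≤ (Φ c) (+-mono-≤ (m≤m+n (κ r) (κ s′)) (m≤m+n (κ r) (κ s′))))

    -- With both recoloured to `c w`, the escape of `w` gains strictly more than
    -- `double (κ r + κ s)`, the largest possible cost. Costs add only for nonadjacent `r` and `s`,
    -- so adjacency has to be excluded separately.
    no-common-neighbour : ∀ {r r′ s s′ w} → Mate r r′ → Mate s s′ → r ≢ s → ¬ Edge s r →
      Edge w r → Edge w s → ⊥
    no-common-neighbour {r} {s = s} {w = w} mate-r mate-s r≢s ¬sr wr ws =
      no-escape d (recolour-cost₂ mate-r mate-s r≢s ¬sr (c w))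
        (escape d r≢s wr ws
          (trans (trans (recolour-other c₁ r≢s) (recolour-self c r)) (≡-sym dw≡))
          (trans (recolour-self c₁ s) (≡-sym dw≡)))
      where
      c₁ = recolour c r (c w)
      d = recolour c₁ s (c w)
      dw≡ : d w ≡ c w
      dw≡ = trans (recolour-other c₁ (adj⇒≢ G κ ws)) (recolour-other c (adj⇒≢ G κ wr))

    -- Removed vertices and the final packing colouring.

    private
      module Lex = StrictTotalOrder (×-strictTotalOrder <-strictTotalOrder (Fin-<-strictTotalOrder n))

    _≺_ : Fin n → Fin n → Set
    x ≺ y = (κ x , x) Lex.< (κ y , y)

    ≺⇒κ≤ : ∀ {x y} → x ≺ y → κ x ≤ κ y
    ≺⇒κ≤ (inj₁ lt)       = <⇒≤ lt
    ≺⇒κ≤ (inj₂ (eq , _)) = ≤-reflexive eq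

    Removed : Fin n → Set
    Removed x = ∃ λ y → Edge x y × c x ≡ c y × x ≺ y

    removed? : ∀ x → Dec (Removed x)
    removed? x = any? λ y → (adj G x y ≟ᵇ true) ×-dec (c x ≟ c y) ×-dec ((κ x , x) Lex.<? (κ y , y))

    mate : ∀ {x} ((y , _) : Removed x) → Mate x y
    mate (_ , xy , same , x≺y) = xy , same , ≺⇒κ≤ x≺y

    monochromatic-edge-removed : ∀ {x y} → Edge x y → c x ≡ c y → ¬ Removed x → ¬ Removed y → ⊥
    monochromatic-edge-removed {x} {y} xy same ¬rx ¬ry with Lex.compare (κ x , x) (κ y , y)
    ... | tri< x≺y _ _       = ¬rx (y , xy , same , x≺y)
    ... | tri≈ _ (_ , x≡y) _ = adj⇒≢ G κ xy x≡y
    ... | tri> _ _ y≺x       = ¬ry (x , adj-sym G κ xy , ≡-sym same , y≺x)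

    -- Applying `adjacent⇒mates` in both directions makes each vertex the witness for removing the
    -- other, which asymmetry of the order rules out.
    removed-nonadjacent : ∀ {r s} → Removed r → Removed s → ¬ Edge r s
    removed-nonadjacent rem-r@(_ , _ , _ , r≺r′) rem-s@(_ , _ , _ , s≺s′) rs
      with adjacent⇒mates (mate rem-r) (mate rem-s) rs
         | adjacent⇒mates (mate rem-s) (mate rem-r) (adj-sym G κ rs)
    ... | refl | refl = Lex.asym r≺r′ s≺s′

    removed-far : ∀ {r s} → Removed r → Removed s → r ≢ s → ¬ DistLe G r s 2
    removed-far rem-r rem-s r≢s (0 , _ , nil) = r≢s refl
    removed-far rem-r rem-s r≢s (1 , _ , cons rs nil) = removed-nonadjacent rem-r rem-s rs
    removed-far rem-r rem-s r≢s (2 , _ , cons rw (cons ws nil)) =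
      no-common-neighbour (mate rem-r) (mate rem-s) r≢s (removed-nonadjacent rem-s rem-r)
        (adj-sym G κ rw) ws
    removed-far rem-r rem-s r≢s (suc (suc (suc _)) , s≤s (s≤s ()) , _)

    kept-far : ∀ {x y} → ¬ Removed x → ¬ Removed y → x ≢ y → c x ≡ c y → ¬ DistLe G x y 1
    kept-far ¬rx ¬ry x≢y same (0 , _ , nil) = x≢y refl
    kept-far ¬rx ¬ry x≢y same (1 , _ , cons xy nil) = monochromatic-edge-removed xy same ¬rx ¬ry
    kept-far ¬rx ¬ry x≢y same (suc (suc _) , s≤s () , _)

    colour : Fin n → Fin (q + 1)
    colour x = if does (removed? x) then q ↑ʳ zero else (c x ↑ˡ 1)

    colour-packing : IsSPackingColoring G (replicate q 1 ++ (2 ∷ [])) colour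
    colour-packing x y x≢y same with removed? x | removed? y
    ... | yes rx | yes ry rewrite lookup-++ʳ (replicate q 1) (2 ∷ []) zero = removed-far rx ry x≢y
    ... | no ¬rx | no ¬ry rewrite lookup-++ˡ (replicate q 1) (2 ∷ []) (c x) | lookup-replicate (c x) 1 =
      kept-far ¬rx ¬ry x≢y (↑ˡ-injective 1 _ _ same)
    ... | yes rx | no ¬ry = contradiction (≡-sym same) (↑ˡ≢↑ʳ (c y) zero)
    ... | no ¬rx | yes ry = contradiction same (↑ˡ≢↑ʳ (c x) zero)

-- The weight bound from saturation.

module Saturation {n q : ℕ} (1≤q : 1 ≤ q) (G : Graph n) (Δ≤ : MaxDegLe G (suc q))
  (saturated : Saturated G (suc q) (q ∸ 1)) where

  k = suc q

  -- Marks degree exactly `k`, the allowed bound, whether or not any vertex attains it.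
  isMaximal : Fin n → ℕ
  isMaximal x = if deg G x ≡ᵇ k then 1 else 0

  isMaximal≤1 : ∀ x → isMaximal x ≤ 1
  isMaximal≤1 x with deg G x ≡ᵇ k
  ... | true  = ≤-refl
  ... | false = z≤n

  sum-weight≡ : ∀ x → sum (weight G isMaximal x) ≡ 2 * deg G x + isMaximal x * kNeighbours G k x
  sum-weight≡ x = begin
    sum (weight G isMaximal x)
      ≡⟨ sum-cong-≗ term ⟩
    sum (λ y → 2 * a y + isMaximal x * b y)
      ≡⟨ ∑-distrib-+ (λ y → 2 * a y) (λ y → isMaximal x * b y) ⟩
    sum (λ y → 2 * a y) + sum (λ y → isMaximal x * b y)
      ≡⟨ cong₂ _+_ (*-distribˡ-sum 2 a) (*-distribˡ-sum (isMaximal x) b) ⟨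
    2 * sum a + isMaximal x * sum b
      ≡⟨ cong₂ (λ s t → 2 * s + isMaximal x * t) (length-filterᵇ-tabulate (adj G x) id)
           (length-filterᵇ-tabulate (λ y → adj G x y ∧ (deg G y ≡ᵇ k)) id) ⟨
    2 * deg G x + isMaximal x * kNeighbours G k x ∎
    where
    open ≡-Reasoning
    a = λ y → if adj G x y then 1 else 0
    b = λ y → if adj G x y ∧ (deg G y ≡ᵇ k) then 1 else 0
    term : ∀ y → weight G isMaximal x y ≡ 2 * a y + isMaximal x * b y
    term y with adj G x y
    ... | true  = refl
    ... | false = ≡-sym (*-zeroʳ (isMaximal x))

  sum-weight≤ : ∀ x → sum (weight G isMaximal x) ≤ q * (2 + isMaximal x) + isMaximal x
  sum-weight≤ x = ≤-trans (≤-reflexive (sum-weight≡ x)) bound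
    where
    open ≤-Reasoning
    arith : ∀ m → 2 * (2 + m) + 1 * m ≡ (1 + m) * 3 + 1
    arith = solve-∀
    bound : 2 * deg G x + isMaximal x * kNeighbours G k x ≤ q * (2 + isMaximal x) + isMaximal x
    bound with deg G x ≡ᵇ k in eq
    ... | true = begin
      -- A `k`-vertex has `k = q + 1` edges of weight at least 2 and at most `k - 2 = q - 1` of
      -- weight 3, in total at most `3 * q + 1`. Writing `q` as `1 + (q ∸ 1)` lets the solver treat
      -- `q ∸ 1` as a variable.
      2 * deg G x + 1 * kNeighbours G k x  ≤⟨ +-mono-≤ (*-monoʳ-≤ 2 (Δ≤ x)) (*-monoʳ-≤ 1 (saturated x deg≡k)) ⟩
      2 * suc q + 1 * (q ∸ 1)              ≡⟨ cong (λ m → 2 * suc m + 1 * (q ∸ 1)) (m+[n∸m]≡n 1≤q) ⟨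
      2 * (2 + (q ∸ 1)) + 1 * (q ∸ 1)      ≡⟨ arith (q ∸ 1) ⟩
      (1 + (q ∸ 1)) * 3 + 1                ≡⟨ cong (λ m → m * 3 + 1) (m+[n∸m]≡n 1≤q) ⟩
      q * 3 + 1                            ∎
      where
      deg≡k : deg G x ≡ k
      deg≡k = ≡ᵇ⇒≡ (deg G x) k (Equivalence.from T-≡ eq)
    ... | false = begin
      -- Below degree `k` all incident edges weigh 2, and there are at most `q` of them.
      2 * deg G x + 0   ≤⟨ +-monoˡ-≤ 0 (*-monoʳ-≤ 2 (s≤s⁻¹ (≤∧≢⇒< (Δ≤ x) deg≢k))) ⟩
      2 * q + 0         ≡⟨ cong (_+ 0) (*-comm 2 q) ⟩
      q * 2 + 0         ∎
      where
      deg≢k : deg G x ≢ k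
      deg≢k deg≡k with () ← trans (≡-sym eq) (Equivalence.to T-≡ (≡⇒≡ᵇ (deg G x) k deg≡k))

theorem3p1 : (k t : ℕ) → 3 ≤ k → 1 ≤ t → t ≤ k ∸ 2 →
    ∀ {n} (G : Graph n) → MaxDegLe G k → Saturated G k t →
    SPackingColorable G (seq1k2 k)
theorem3p1 (suc q@(suc (suc _))) t (s≤s 2≤q@(s≤s (s≤s _))) _ t≤k∸2 G Δ≤k saturated = colour , colour-packing
  where
  open Saturation (≤-trans (s≤s z≤n) 2≤q) G Δ≤k (λ v deg≡k → ≤-trans (saturated v deg≡k) t≤k∸2)
  open Extremal 2≤q G isMaximal isMaximal≤1 sum-weight≤
  -- Matching `q` as a double successor exposes the nonempty colour set that `minimiser` requires.
  minimal = minimiser (monochromatic (weight G isMaximal)) (monochromatic-cong (weight G isMaximal))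
  open Minimal (proj₁ minimal) (proj₂ minimal)
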